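{- If $G$ is a $C_{4k}$-free bipartite graph, then $\operatorname{null}(G)=|V(G)|-2\nu(G)$.
   Context: All graphs are finite, simple and undirected. A graph is a $C_{4k}$-free bipartite graph if it is bipartite and contains no cycle whose length is a multiple of $4$. $\operatorname{null}(G)$ is the dimension of the null space of the adjacency matrix of $G$, and $\nu(G)$ is the matching number of $G$ (the size of a maximum matching). -}

module Defs where

open import Data.Nat using (ℕ; zero; suc; _+_; _*_; _≤_)
open import Data.Nat.Divisibility using (_∣_)
open import Data.Fin using (Fin; toℕ) renaming (zero to fzero; suc to fsuc)
open import Data.Bool using (Bool; true; false; if_then_else_)
open import Data.Product using (Σ; _×_; ∃)
open import Relation.Binary.PropositionalEquality using (_≡_; _≢_)
open import Relation.Nullary using (¬_)
open import Function.Definitions using (Injective)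
open import Data.Rational using (ℚ; 0ℚ; 1ℚ) renaming (_+_ to _+ℚ_; _*_ to _*ℚ_)

record Graph : Set where
  field
    n     : ℕ
    adj   : Fin n → Fin n → Bool
    sym   : ∀ i j → adj i j ≡ adj j i
    irrefl : ∀ i → adj i i ≡ false
open Graph public

Adj : (G : Graph) → Fin (n G) → Fin (n G) → Set
Adj G i j = adj G i j ≡ true

IsBipartite : Graph → Set
IsBipartite G = Σ (Fin (n G) → Bool) λ c → ∀ i j → Adj G i j → c i ≢ c j

record Cycle (G : Graph) (L : ℕ) : Set where
  field
    len≥3  : 3 ≤ L
    vtx    : Fin L → Fin (n G)
    inj    : Injective _≡_ _≡_ vtx
    step   : ∀ (i j : Fin L) → suc (toℕ i) ≡ toℕ j → Adj G (vtx i) (vtx j)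
    close  : ∀ (i j : Fin L) → suc (toℕ i) ≡ L → toℕ j ≡ 0 → Adj G (vtx i) (vtx j)

IsC4kFree : Graph → Set
IsC4kFree G = ∀ L → 4 ∣ L → ¬ Cycle G L

record Matching (G : Graph) (m : ℕ) : Set where
  field
    left  : Fin m → Fin (n G)
    right : Fin m → Fin (n G)
    edge  : ∀ i → Adj G (left i) (right i)
    injL  : Injective _≡_ _≡_ left
    injR  : Injective _≡_ _≡_ right
    disj  : ∀ i j → left i ≢ right j

IsMatchingNumber : Graph → ℕ → Set
IsMatchingNumber G m = Matching G m × ¬ Matching G (suc m)

sumℚ : ∀ {k} → (Fin k → ℚ) → ℚ
sumℚ {zero} f = 0ℚ
sumℚ {suc k} f = f fzero +ℚ sumℚ (λ i → f (fsuc i))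

adjMatrix : (G : Graph) → Fin (n G) → Fin (n G) → ℚ
adjMatrix G i j = if adj G i j then 1ℚ else 0ℚ

InNullSpace : (G : Graph) → (Fin (n G) → ℚ) → Set
InNullSpace G x = ∀ i → sumℚ (λ j → adjMatrix G i j *ℚ x j) ≡ 0ℚ

LinIndep : ∀ {k d} → (Fin d → Fin k → ℚ) → Set
LinIndep {k} {d} v =
  ∀ (c : Fin d → ℚ) → (∀ j → sumℚ (λ i → c i *ℚ v i j) ≡ 0ℚ) → ∀ i → c i ≡ 0ℚ

IndepNullFamily : Graph → ℕ → Set
IndepNullFamily G d =
  Σ (Fin d → Fin (n G) → ℚ) λ v → LinIndep v × (∀ i → InNullSpace G (v i))

IsNullity : Graph → ℕ → Set
IsNullity G d = IndepNullFamily G d × ¬ IndepNullFamily G (suc d)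

{-# OPTIONS --safe #-}

-- Both inequalities avoid determinants and König's theorem.
--
-- n ≤ null + 2ν: choose n − null independent rows of the adjacency matrix A.  A transversal through
-- nonzero entries of A matches the chosen rows of either colour into the other colour class, so each
-- colour contributes at most ν rows.
--
-- null + 2ν ≤ n: let x be a null vector supported on the vertices of a matching, with x v ≠ 0.  The
-- equation A x = 0 at the partner v′ of v has the nonzero term x v, hence a term x w of opposite sign.
-- Iterating v, v′, w, w′, … gives a walk in which the pair (colour, sign) has period 4, so its first
-- closed segment is a cycle of length divisible by 4.  Hence x = 0, which says that null vectors are
-- independent of the 2ν unit vectors at matched vertices.
module Submission where

open import Defs renaming (sym to adj-sym)
open import Data.Nat using (ℕ; _+_; _*_)
open import Relation.Binary.PropositionalEquality using (_≡_)

open import Algebra.Bundles using (CommutativeRing)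
open import Data.Nat using (zero; suc; _∸_; >-nonZero; _≤_; _<_)
open import Data.Fin using (Fin; toℕ; splitAt; join; inject≤; _↑ˡ_; _↑ʳ_; punchIn; _≟_)
  renaming (zero to fzero; suc to fsuc)
import Data.Fin.Properties as Fin
import Data.Nat.Properties as ℕ
open import Data.Nat.Divisibility using (_∣_; _∣0; ∣-refl; ∣⇒≤; ∣m∣n⇒∣m+n)
open import Data.Nat.GeneralisedArithmetic using (fold; fold-+)
open import Data.Nat.Induction using (Acc; acc; <-wellFounded)
open import Data.Bool using (Bool; true; false; not; if_then_else_)
open import Data.Bool.Properties as Bool using (not-involutive; not-injective; ¬-not)
open import Data.Sum as Sum using (_⊎_; inj₁; inj₂; [_,_])
open import Data.Product using (_×_; _,_; ∃; ∃₂; proj₁; proj₂)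
open import Data.Rational using (ℚ; 0ℚ; 1ℚ; -_; 1/_; NonZero; ≢-nonZero)
  renaming (_+_ to _+ℚ_; _*_ to _*ℚ_)
import Data.Rational as ℚ using (_≤_; _<_)
import Data.Rational.Properties as ℚ
open import Data.Rational.Solver using (module +-*-Solver)
open import Data.Vec.Functional using (_∷_; _++_; insertAt)
open import Data.Vec.Functional.Properties using (insertAt-lookup; insertAt-punchIn; lookup-++ˡ; lookup-++ʳ)
open import Function using (_∘_; id; const)
open import Function.Definitions using (Injective)
open import Relation.Binary.PropositionalEquality
  using (_≢_; _≗_; refl; sym; trans; cong; cong₂; subst; module ≡-Reasoning)
open import Relation.Binary using (tri<; tri≈; tri>)
open import Relation.Nullary using (¬_; Dec; yes; no; contradiction; does)
open import Relation.Nullary.Decidable using (dec-true; dec-false; _×-dec_; ¬?; decidable-stable)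

import Algebra.Properties.Semiring.Sum (CommutativeRing.semiring ℚ.+-*-commutativeRing) as Σℚ

private variable
  d e k s : ℕ

-- Finite sums of rationals.

sumℚ≡sum : (f : Fin k → ℚ) → sumℚ f ≡ Σℚ.sum f
sumℚ≡sum {zero}  f = refl
sumℚ≡sum {suc k} f = cong (f fzero +ℚ_) (sumℚ≡sum (f ∘ fsuc))

sumℚ-cong : {f g : Fin k → ℚ} → f ≗ g → sumℚ f ≡ sumℚ g
sumℚ-cong {zero}  f≗g = refl
sumℚ-cong {suc k} f≗g = cong₂ _+ℚ_ (f≗g fzero) (sumℚ-cong (f≗g ∘ fsuc))

sumℚ-zero : {f : Fin k → ℚ} → (∀ i → f i ≡ 0ℚ) → sumℚ f ≡ 0ℚ
sumℚ-zero {zero}  f≗0 = refl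
sumℚ-zero {suc k} f≗0 = cong₂ _+ℚ_ (f≗0 fzero) (sumℚ-zero (f≗0 ∘ fsuc))

sumℚ-single : {f : Fin k → ℚ} (i : Fin k) → (∀ j → j ≢ i → f j ≡ 0ℚ) → sumℚ f ≡ f i
sumℚ-single {f = f} fzero    f≗0 =
  trans (cong (f fzero +ℚ_) (sumℚ-zero λ j → f≗0 (fsuc j) λ ())) (ℚ.+-identityʳ _)
sumℚ-single {f = f} (fsuc i) f≗0 =
  trans (cong₂ _+ℚ_ (f≗0 fzero λ ()) (sumℚ-single i λ j j≢i → f≗0 (fsuc j) (j≢i ∘ Fin.suc-injective)))
        (ℚ.+-identityˡ _)

sumℚ-+ : (f g : Fin k → ℚ) → sumℚ (λ i → f i +ℚ g i) ≡ sumℚ f +ℚ sumℚ g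
sumℚ-+ f g = trans (sumℚ≡sum (λ i → f i +ℚ g i))
  (trans (Σℚ.∑-distrib-+ f g) (sym (cong₂ _+ℚ_ (sumℚ≡sum f) (sumℚ≡sum g))))

sumℚ-*ˡ : (a : ℚ) (f : Fin k → ℚ) → sumℚ (λ i → a *ℚ f i) ≡ a *ℚ sumℚ f
sumℚ-*ˡ a f = trans (sumℚ≡sum (λ i → a *ℚ f i))
  (sym (trans (cong (a *ℚ_) (sumℚ≡sum f)) (Σℚ.*-distribˡ-sum a f)))

sumℚ-swap : (f : Fin d → Fin k → ℚ) →
  sumℚ (λ i → sumℚ (λ j → f i j)) ≡ sumℚ (λ j → sumℚ (λ i → f i j))
sumℚ-swap f = trans (double f) (trans (Σℚ.∑-comm f) (sym (double λ j i → f i j)))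
  where
  double : (f : Fin d → Fin k → ℚ) →
    sumℚ (λ i → sumℚ (f i)) ≡ Σℚ.sum (λ i → Σℚ.sum (f i))
  double f = trans (sumℚ-cong (λ i → sumℚ≡sum (f i))) (sumℚ≡sum λ i → Σℚ.sum (f i))

sumℚ-remove : (i : Fin (suc k)) (f : Fin (suc k) → ℚ) →
  sumℚ f ≡ f i +ℚ sumℚ (f ∘ punchIn i)
sumℚ-remove i f = trans (sumℚ≡sum f)
  (trans (Σℚ.sum-remove f) (cong (f i +ℚ_) (sym (sumℚ≡sum (f ∘ punchIn i)))))

sumℚ-split : (f : Fin (d + k) → ℚ) → sumℚ f ≡ sumℚ (f ∘ (_↑ˡ k)) +ℚ sumℚ (f ∘ (d ↑ʳ_))
sumℚ-split {zero}  f = sym (ℚ.+-identityˡ _)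
sumℚ-split {suc d} f =
  trans (cong (f fzero +ℚ_) (sumℚ-split {d} (f ∘ fsuc))) (sym (ℚ.+-assoc (f fzero) _ _))

*-cancel-0ˡ : ∀ p q → p ≢ 0ℚ → p *ℚ q ≡ 0ℚ → q ≡ 0ℚ
*-cancel-0ˡ p q p≢0 pq≡0 = begin
  q                   ≡⟨ ℚ.*-identityˡ q ⟨
  1ℚ *ℚ q             ≡⟨ cong (_*ℚ q) (ℚ.*-inverseˡ p) ⟨
  (1/ p *ℚ p) *ℚ q    ≡⟨ ℚ.*-assoc (1/ p) p q ⟩
  1/ p *ℚ (p *ℚ q)    ≡⟨ cong (1/ p *ℚ_) pq≡0 ⟩
  1/ p *ℚ 0ℚ          ≡⟨ ℚ.*-zeroʳ (1/ p) ⟩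
  0ℚ                  ∎
  where
  open ≡-Reasoning
  instance
    p-nonZero : NonZero p
    p-nonZero = ≢-nonZero p≢0

-- Dot products, linear combinations, unit vectors and independence.

infix 8 _∙_

_∙_ : (Fin k → ℚ) → (Fin k → ℚ) → ℚ
x ∙ y = sumℚ λ j → x j *ℚ y j

comb : (Fin d → ℚ) → (Fin d → Fin k → ℚ) → Fin k → ℚ
comb c v j = c ∙ λ i → v i j

∙-comm : (x y : Fin k → ℚ) → x ∙ y ≡ y ∙ x
∙-comm x y = sumℚ-cong λ i → ℚ.*-comm (x i) (y i)

∙-congˡ : (x : Fin k → ℚ) {y z : Fin k → ℚ} → y ≗ z → x ∙ y ≡ x ∙ z
∙-congˡ x y≗z = sumℚ-cong λ i → cong (x i *ℚ_) (y≗z i)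

∙-zeroʳ : (x : Fin k → ℚ) {y : Fin k → ℚ} → (∀ i → y i ≡ 0ℚ) → x ∙ y ≡ 0ℚ
∙-zeroʳ x y≗0 = sumℚ-zero λ i → trans (cong (x i *ℚ_) (y≗0 i)) (ℚ.*-zeroʳ (x i))

∙-zeroˡ : {x : Fin k → ℚ} (y : Fin k → ℚ) → (∀ i → x i ≡ 0ℚ) → x ∙ y ≡ 0ℚ
∙-zeroˡ {x = x} y x≗0 = trans (∙-comm x y) (∙-zeroʳ y x≗0)

-- Associativity of the product row · matrix · column, by exchanging the two sums.
comb-∙ : (c : Fin d → ℚ) (v : Fin d → Fin k → ℚ) (x : Fin k → ℚ) →
  comb c v ∙ x ≡ c ∙ λ i → v i ∙ x
comb-∙ c v x = begin
  sumℚ (λ j → sumℚ (λ i → c i *ℚ v i j) *ℚ x j)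
    ≡⟨ sumℚ-cong (λ j → trans (ℚ.*-comm _ (x j)) (sym (sumℚ-*ˡ (x j) λ i → c i *ℚ v i j))) ⟩
  sumℚ (λ j → sumℚ (λ i → x j *ℚ (c i *ℚ v i j)))
    ≡⟨ sumℚ-swap (λ j i → x j *ℚ (c i *ℚ v i j)) ⟩
  sumℚ (λ i → sumℚ (λ j → x j *ℚ (c i *ℚ v i j)))
    ≡⟨ sumℚ-cong (λ i → sumℚ-cong λ j →
         +-*-Solver.solve 3 (λ a b c → a :* (b :* c) := b :* (c :* a)) refl (x j) (c i) (v i j)) ⟩
  sumℚ (λ i → sumℚ (λ j → c i *ℚ (v i j *ℚ x j)))
    ≡⟨ sumℚ-cong (λ i → sumℚ-*ˡ (c i) λ j → v i j *ℚ x j) ⟩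
  sumℚ (λ i → c i *ℚ v i ∙ x) ∎
  where
  open ≡-Reasoning
  open +-*-Solver using (_:*_; _:=_)

δ : Fin k → Fin k → ℚ
δ i j = if does (i ≟ j) then 1ℚ else 0ℚ

δ-diag : {i j : Fin k} → i ≡ j → δ i j ≡ 1ℚ
δ-diag {i = i} {j} i≡j rewrite dec-true (i ≟ j) i≡j = refl

δ-off : {i j : Fin k} → i ≢ j → δ i j ≡ 0ℚ
δ-off {i = i} {j} i≢j rewrite dec-false (i ≟ j) i≢j = refl

δ-∙ : (i : Fin k) (x : Fin k → ℚ) → δ i ∙ x ≡ x i
δ-∙ i x = trans
  (sumℚ-single i λ j j≢i → trans (cong (_*ℚ x j) (δ-off (j≢i ∘ sym))) (ℚ.*-zeroˡ (x j)))
  (trans (cong (_*ℚ x i) (δ-diag {i = i} refl)) (ℚ.*-identityˡ (x i)))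

comb-δ : (c : Fin d → ℚ) {ι : Fin d → Fin k} → Injective _≡_ _≡_ ι →
  ∀ i → comb c (δ ∘ ι) (ι i) ≡ c i
comb-δ c {ι} ι-inj i = trans
  (sumℚ-single i λ j j≢i → trans (cong (c j *ℚ_) (δ-off (j≢i ∘ ι-inj))) (ℚ.*-zeroʳ (c j)))
  (trans (cong (c i *ℚ_) (δ-diag {i = ι i} refl)) (ℚ.*-identityʳ (c i)))

comb-δ-outside : (c : Fin d → ℚ) {ι : Fin d → Fin k} {j : Fin k} → (∀ i → ι i ≢ j) →
  comb c (δ ∘ ι) j ≡ 0ℚ
comb-δ-outside c j∉ι = ∙-zeroʳ c λ i → δ-off (j∉ι i)

LinIndep-δ : {ι : Fin d → Fin k} → Injective _≡_ _≡_ ι → LinIndep (δ ∘ ι)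
LinIndep-δ {ι = ι} ι-inj c comb≗0 i = trans (sym (comb-δ c ι-inj i)) (comb≗0 (ι i))

-- The vector `comb c (δ ∘ ι)` is `c` pushed forward along `ι`, with zeros off its image. It turns a
-- relation among the selected vectors into a relation among all of them.
LinIndep-∘ : {v : Fin d → Fin k → ℚ} {ι : Fin e → Fin d} →
  LinIndep v → Injective _≡_ _≡_ ι → LinIndep (v ∘ ι)
LinIndep-∘ {v = v} {ι} v-indep ι-inj c comb≗0 i =
  trans (sym (comb-δ c ι-inj i)) (v-indep (comb c (δ ∘ ι)) extended≗0 (ι i))
  where
  extended≗0 : ∀ j → comb (comb c (δ ∘ ι)) v j ≡ 0ℚ
  extended≗0 j = trans (comb-∙ c (δ ∘ ι) (λ l → v l j))
    (trans (∙-congˡ c λ l → δ-∙ (ι l) (λ m → v m j)) (comb≗0 j))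

-- The last hypothesis says that the two spans meet only in 0. It speaks of the `v`-part alone,
-- because the vanishing of the `w`-part then follows from the sum.
LinIndep-++ : {v : Fin d → Fin k → ℚ} {w : Fin e → Fin k → ℚ} → LinIndep v → LinIndep w →
  (∀ a b → (∀ j → comb a v j +ℚ comb b w j ≡ 0ℚ) → ∀ j → comb a v j ≡ 0ℚ) →
  LinIndep (v ++ w)
LinIndep-++ {d} {k} {e} {v} {w} v-indep w-indep disjoint c comb≗0 i =
  subst (λ i → c i ≡ 0ℚ) (Fin.join-splitAt d e i) (blockwise (splitAt d i))
  where
  a : Fin d → ℚ
  a = c ∘ (_↑ˡ e)
  b : Fin e → ℚ
  b = c ∘ (d ↑ʳ_)
  sum≗0 : ∀ j → comb a v j +ℚ comb b w j ≡ 0ℚ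
  sum≗0 j = trans (sym (trans (sumℚ-split {d} λ i → c i *ℚ (v ++ w) i j)
    (cong₂ _+ℚ_ (∙-congˡ a λ i → cong (λ x → x j) (lookup-++ˡ v w i))
                (∙-congˡ b λ i → cong (λ x → x j) (lookup-++ʳ v w i))))) (comb≗0 j)
  v-part≗0 : ∀ j → comb a v j ≡ 0ℚ
  v-part≗0 = disjoint a b sum≗0
  w-part≗0 : ∀ j → comb b w j ≡ 0ℚ
  w-part≗0 j = trans (sym (ℚ.+-identityˡ _))
    (trans (cong (_+ℚ comb b w j) (sym (v-part≗0 j))) (sum≗0 j))
  blockwise : ∀ s → c (join d e s) ≡ 0ℚ
  blockwise (inj₁ i) = v-indep a v-part≗0 i
  blockwise (inj₂ i) = w-indep b w-part≗0 i

-- Rank and nullity by elimination.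

-- A certificate for the rank: two independent families, one of rows and one of kernel vectors. The
-- equation `rank+nullity` forces both to be maximal.
record RankNullity (R : Fin d → Fin k → ℚ) : Set where
  field
    rank nullity     : ℕ
    rank+nullity     : rank + nullity ≡ k
    pick             : Fin rank → Fin d
    pick-injective   : Injective _≡_ _≡_ pick
    pick-independent : LinIndep (R ∘ pick)
    ker              : Fin nullity → Fin k → ℚ
    ker-independent  : LinIndep ker
    ker-null         : ∀ i l → R i ∙ ker l ≡ 0ℚ

-- One elimination step on kernel vectors; cross-multiplying instead of dividing by φ ∙ ker p keeps
-- the coefficients free of inverses.
module Pivot (φ : Fin k → ℚ) (ker : Fin (suc s) → Fin k → ℚ) (p : Fin (suc s)) where

  reduce : Fin s → Fin k → ℚ
  reduce i j = (φ ∙ ker p) *ℚ ker (punchIn p i) j +ℚ (- (φ ∙ ker (punchIn p i))) *ℚ ker p j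

  ∙-reduce : ∀ x i → x ∙ reduce i
    ≡ (φ ∙ ker p) *ℚ (x ∙ ker (punchIn p i)) +ℚ (- (φ ∙ ker (punchIn p i))) *ℚ (x ∙ ker p)
  ∙-reduce x i = begin
    x ∙ reduce i
      ≡⟨ sumℚ-cong (λ j → solve 5 (λ x a u b w → x :* (a :* u :+ b :* w) := a :* (x :* u) :+ b :* (x :* w))
           refl (x j) α (ker (punchIn p i) j) β (ker p j)) ⟩
    sumℚ (λ j → α *ℚ (x j *ℚ ker (punchIn p i) j) +ℚ β *ℚ (x j *ℚ ker p j))
      ≡⟨ sumℚ-+ (λ j → α *ℚ (x j *ℚ ker (punchIn p i) j)) (λ j → β *ℚ (x j *ℚ ker p j)) ⟩
    _ ≡⟨ cong₂ _+ℚ_ (sumℚ-*ˡ α λ j → x j *ℚ ker (punchIn p i) j) (sumℚ-*ˡ β λ j → x j *ℚ ker p j) ⟩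
    α *ℚ (x ∙ ker (punchIn p i)) +ℚ β *ℚ (x ∙ ker p) ∎
    where
    open ≡-Reasoning
    open +-*-Solver using (solve; _:+_; _:*_; _:=_)
    α β : ℚ
    α = φ ∙ ker p
    β = - (φ ∙ ker (punchIn p i))

  reduce-null : ∀ i → φ ∙ reduce i ≡ 0ℚ
  reduce-null i = trans (∙-reduce φ i)
    (solve 2 (λ a b → a :* b :+ (:- b) :* a := con 0ℚ) refl (φ ∙ ker p) (φ ∙ ker (punchIn p i)))
    where open +-*-Solver

  -- A relation `c` among the reduced vectors unfolds to the relation `c⁺` among the original ones:
  -- each coefficient off the pivot is scaled by `φ ∙ ker p`, and `γ` collects the multiples of
  -- `ker p`.
  reduce-independent : LinIndep ker → φ ∙ ker p ≢ 0ℚ → LinIndep reduce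
  reduce-independent ker-indep φp≢0 c comb≗0 i = *-cancel-0ˡ (φ ∙ ker p) (c i) φp≢0
    (trans (sym (insertAt-punchIn scaled p γ i)) (ker-indep c⁺ c⁺≗0 (punchIn p i)))
    where
    open +-*-Solver
    scaled : Fin s → ℚ
    scaled i = (φ ∙ ker p) *ℚ c i
    μ : Fin s → ℚ
    μ i = - (φ ∙ ker (punchIn p i))
    γ : ℚ
    γ = c ∙ μ
    c⁺ : Fin (suc s) → ℚ
    c⁺ = insertAt scaled p γ
    c⁺≗0 : ∀ j → comb c⁺ ker j ≡ 0ℚ
    c⁺≗0 j = begin
      comb c⁺ ker j
        ≡⟨ sumℚ-remove p (λ i → c⁺ i *ℚ ker i j) ⟩
      c⁺ p *ℚ ker p j +ℚ sumℚ (λ i → c⁺ (punchIn p i) *ℚ ker (punchIn p i) j)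
        ≡⟨ cong₂ _+ℚ_ (trans (cong (_*ℚ ker p j) (insertAt-lookup scaled p γ)) (ℚ.*-comm γ (ker p j)))
                      (sumℚ-cong λ i → cong (_*ℚ ker (punchIn p i) j) (insertAt-punchIn scaled p γ i)) ⟩
      ker p j *ℚ γ +ℚ sumℚ (λ i → scaled i *ℚ ker (punchIn p i) j)
        ≡⟨ cong (_+ℚ sumℚ λ i → scaled i *ℚ ker (punchIn p i) j) (sumℚ-*ˡ (ker p j) λ i → c i *ℚ μ i) ⟨
      sumℚ (λ i → ker p j *ℚ (c i *ℚ μ i)) +ℚ sumℚ (λ i → scaled i *ℚ ker (punchIn p i) j)
        ≡⟨ sumℚ-+ (λ i → ker p j *ℚ (c i *ℚ μ i)) (λ i → scaled i *ℚ ker (punchIn p i) j) ⟨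
      sumℚ (λ i → ker p j *ℚ (c i *ℚ μ i) +ℚ scaled i *ℚ ker (punchIn p i) j)
        ≡⟨ sumℚ-cong (λ i → solve 5 (λ w c b a u → w :* (c :* b) :+ a :* c :* u := c :* (a :* u :+ b :* w))
             refl (ker p j) (c i) (μ i) (φ ∙ ker p) (ker (punchIn p i) j)) ⟩
      comb c reduce j
        ≡⟨ comb≗0 j ⟩
      0ℚ ∎
      where open ≡-Reasoning

-- Induction on the rows. With no rows the kernel is the whole space. A new row either annihilates
-- the current kernel and is not picked, or it is picked and costs one kernel vector.
rankNullity : (R : Fin d → Fin k → ℚ) → RankNullity R
rankNullity {zero} {k} R = record
  { rank = 0; nullity = k; rank+nullity = refl
  ; pick = λ (); pick-injective = λ {}; pick-independent = λ _ _ ()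
  ; ker = δ; ker-independent = LinIndep-δ id; ker-null = λ () }
rankNullity {suc d} {k} R = extend (rankNullity (R ∘ fsuc))
  where
  φ : Fin k → ℚ
  φ = R fzero
  module _ (T : RankNullity (R ∘ fsuc)) where
    open RankNullity T
    killed : (∀ l → φ ∙ ker l ≡ 0ℚ) → RankNullity R
    killed φ-null = record
      { rank = rank; nullity = nullity; rank+nullity = rank+nullity
      ; pick = fsuc ∘ pick; pick-injective = pick-injective ∘ Fin.suc-injective
      ; pick-independent = pick-independent
      ; ker = ker; ker-independent = ker-independent
      ; ker-null = λ { fzero → φ-null ; (fsuc i) → ker-null i } }
    -- The kernel data are passed in anew, so that the nullity can be written as a successor.
    pivot : ∀ {ν} (eq : rank + suc ν ≡ k) (ker : Fin (suc ν) → Fin k → ℚ) → LinIndep ker →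
      (∀ i l → R (fsuc i) ∙ ker l ≡ 0ℚ) → (p : Fin (suc ν)) → φ ∙ ker p ≢ 0ℚ → RankNullity R
    pivot {ν} eq ker ker-indep ker-null p φp≢0 = record
      { rank = suc rank; nullity = ν; rank+nullity = trans (sym (ℕ.+-suc rank ν)) eq
      ; pick = pick⁺; pick-injective = pick⁺-injective; pick-independent = pick⁺-independent
      ; ker = reduce; ker-independent = reduce-independent ker-indep φp≢0
      ; ker-null = λ { fzero → reduce-null ; (fsuc i) → reduce-null′ i } }
      where
      open Pivot φ ker p
      reduce-null′ : ∀ i l → R (fsuc i) ∙ reduce l ≡ 0ℚ
      reduce-null′ i l = trans (∙-reduce (R (fsuc i)) l)
        (cong₂ _+ℚ_ (trans (cong ((φ ∙ ker p) *ℚ_) (ker-null i (punchIn p l))) (ℚ.*-zeroʳ (φ ∙ ker p)))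
                    (trans (cong ((- (φ ∙ ker (punchIn p l))) *ℚ_) (ker-null i p))
                           (ℚ.*-zeroʳ (- (φ ∙ ker (punchIn p l))))))
      pick⁺ : Fin (suc rank) → Fin (suc d)
      pick⁺ fzero    = fzero
      pick⁺ (fsuc i) = fsuc (pick i)
      pick⁺-injective : Injective _≡_ _≡_ pick⁺
      pick⁺-injective {fzero}  {fzero}  _  = refl
      pick⁺-injective {fsuc i} {fsuc j} eq = cong fsuc (pick-injective (Fin.suc-injective eq))
      -- Pairing a vanishing combination with ker p leaves only the coefficient of φ.
      pick⁺-independent : LinIndep (R ∘ pick⁺)
      pick⁺-independent c comb≗0 = λ { fzero → c₀≡0 ; (fsuc i) → pick-independent (c ∘ fsuc) tail≗0 i }
        where
        paired : comb c (R ∘ pick⁺) ∙ ker p ≡ c fzero *ℚ (φ ∙ ker p)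
        paired = trans (comb-∙ c (R ∘ pick⁺) (ker p))
          (trans (cong (c fzero *ℚ (φ ∙ ker p) +ℚ_)
                   (∙-zeroʳ (c ∘ fsuc) λ i → ker-null (pick i) p))
                 (ℚ.+-identityʳ _))
        c₀≡0 : c fzero ≡ 0ℚ
        c₀≡0 = *-cancel-0ˡ (φ ∙ ker p) (c fzero) φp≢0
          (trans (ℚ.*-comm _ (c fzero)) (trans (sym paired) (∙-zeroˡ (ker p) comb≗0)))
        tail≗0 : ∀ j → comb (c ∘ fsuc) (R ∘ fsuc ∘ pick) j ≡ 0ℚ
        tail≗0 j = begin
          comb (c ∘ fsuc) (R ∘ fsuc ∘ pick) j
            ≡⟨ ℚ.+-identityˡ _ ⟨
          0ℚ +ℚ comb (c ∘ fsuc) (R ∘ fsuc ∘ pick) j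
            ≡⟨ cong (_+ℚ comb (c ∘ fsuc) (R ∘ fsuc ∘ pick) j)
                 (trans (cong (_*ℚ φ j) c₀≡0) (ℚ.*-zeroˡ (φ j))) ⟨
          comb c (R ∘ pick⁺) j
            ≡⟨ comb≗0 j ⟩
          0ℚ ∎
          where open ≡-Reasoning
  extend : RankNullity (R ∘ fsuc) → RankNullity R
  extend T with Fin.any? (λ l → ¬? (φ ∙ RankNullity.ker T l ℚ.≟ 0ℚ))
  ... | no ∄ = killed T λ l → decidable-stable (φ ∙ RankNullity.ker T l ℚ.≟ 0ℚ) λ ≢0 → ∄ (l , ≢0)
  ... | yes (p , φp≢0) = pivotOf T p φp≢0
    where
    pivotOf : (T : RankNullity (R ∘ fsuc)) (p : Fin (RankNullity.nullity T)) →
      φ ∙ RankNullity.ker T p ≢ 0ℚ → RankNullity R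
    pivotOf T@record { nullity = suc ν } p φp≢0 =
      pivot T (RankNullity.rank+nullity T) (RankNullity.ker T)
        (RankNullity.ker-independent T) (RankNullity.ker-null T) p φp≢0

-- For the transposed matrix the kernel vectors are the relations among the `v i`. All of them
-- vanish, so the nullity is 0, the rank is `d`, and `pick` injects `Fin d` into `Fin k`.
LinIndep⇒≤ : {v : Fin d → Fin k → ℚ} → LinIndep v → d ≤ k
LinIndep⇒≤ {d} {k} {v} v-indep = subst (_≤ k) rank≡d (Fin.injective⇒≤ pick-injective)
  where
  open RankNullity (rankNullity λ j i → v i j)
  nullity≡0 : ∀ {ν} {ker : Fin ν → Fin d → ℚ} → LinIndep ker →
    (∀ j l → (λ i → v i j) ∙ ker l ≡ 0ℚ) → ν ≡ 0
  nullity≡0 {zero}       _     _    = refl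
  -- A nonempty family of zero vectors is dependent, with all coefficients 1.
  nullity≡0 {suc ν} {ker} indep null = contradiction
    (indep (const 1ℚ) (λ i → ∙-zeroʳ (const 1ℚ) λ l → ker≗0 l i) fzero) ℚ.1≢0
    where
    ker≗0 : ∀ l i → ker l i ≡ 0ℚ
    ker≗0 l = v-indep (ker l) λ j → trans (∙-comm (ker l) _) (null j l)
  rank≡d : rank ≡ d
  rank≡d = trans (sym (ℕ.+-identityʳ rank))
    (trans (cong (rank +_) (sym (nullity≡0 ker-independent ker-null))) rank+nullity)

-- Transversals of independent rows.

-- Double-negation shift, available because the index set is finite.
¬¬-∀-Fin : {P : Fin k → Set} → (∀ i → ¬ ¬ P i) → ¬ ¬ (∀ i → P i)
¬¬-∀-Fin {zero}  _    ¬∀ = ¬∀ λ ()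
¬¬-∀-Fin {suc k} ¬¬P ¬∀ = ¬¬P fzero λ p₀ → ¬¬-∀-Fin (¬¬P ∘ fsuc) λ p → ¬∀ (Fin.∀-cons p₀ p)

-- The column is zeroed, not deleted, so the index type stays the same. A transversal of the erased
-- rows avoids column `l` because its entries are nonzero.
eraseAt : Fin k → (Fin k → ℚ) → Fin k → ℚ
eraseAt l x j = if does (l ≟ j) then 0ℚ else x j

eraseAt-diag : {l j : Fin k} (x : Fin k → ℚ) → l ≡ j → eraseAt l x j ≡ 0ℚ
eraseAt-diag {l = l} {j} x l≡j rewrite dec-true (l ≟ j) l≡j = refl

eraseAt-off : {l j : Fin k} (x : Fin k → ℚ) → l ≢ j → eraseAt l x j ≡ x j
eraseAt-off {l = l} {j} x l≢j rewrite dec-false (l ≟ j) l≢j = refl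

Transversal : (Fin d → Fin k → ℚ) → Set
Transversal {d} {k} v = ∃ λ (f : Fin d → Fin k) → Injective _≡_ _≡_ f × (∀ i → v i (f i) ≢ 0ℚ)

-- The first row is the sum of its entries times unit vectors. If each unit vector in its support
-- lay in the span of the other rows, so would the first row, against independence.
head∉span-tail : {v : Fin (suc d) → Fin k → ℚ} → LinIndep v →
  ¬ (∀ l → ∃ λ g → v fzero l ≢ 0ℚ → ∀ j → comb g (v ∘ fsuc) j ≡ δ l j)
head∉span-tail {d} {k} {v} v-indep units =
  contradiction (v-indep (- 1ℚ ∷ G) vanishes fzero) λ ()
  where
  g : Fin k → Fin d → ℚ
  g l = proj₁ (units l)
  G : Fin d → ℚ
  G = comb (v fzero) g
  term : ∀ l j → v fzero l *ℚ comb (g l) (v ∘ fsuc) j ≡ v fzero l *ℚ δ l j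
  term l j with v fzero l ℚ.≟ 0ℚ
  ... | yes ≡0 rewrite ≡0 = trans (ℚ.*-zeroˡ (comb (g l) (v ∘ fsuc) j)) (sym (ℚ.*-zeroˡ (δ l j)))
  ... | no  ≢0 = cong (v fzero l *ℚ_) (proj₂ (units l) ≢0 j)
  span : ∀ j → comb G (v ∘ fsuc) j ≡ v fzero j
  span j = trans (comb-∙ (v fzero) g (λ i → v (fsuc i) j))
    (trans (sumℚ-cong λ l → term l j) (comb-δ (v fzero) id j))
  vanishes : ∀ j → comb (- 1ℚ ∷ G) v j ≡ 0ℚ
  vanishes j = trans (cong (- 1ℚ *ℚ v fzero j +ℚ_) (span j))
    (solve 1 (λ x → con (- 1ℚ) :* x :+ x := con 0ℚ) refl (v fzero j))
    where open +-*-Solver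

-- For a relation `c` among the erased rows, `comb c v` is a multiple of `δ l`. If the multiple is
-- 0, `c` is a relation among the `v i` and vanishes; otherwise dividing by it gives `δ l`.
eraseAt-dependent : {v : Fin d → Fin k → ℚ} (l : Fin k) → LinIndep v →
  ¬ LinIndep (eraseAt l ∘ v) → ¬ ¬ (∃ λ g → ∀ j → comb g v j ≡ δ l j)
eraseAt-dependent {v = v} l v-indep ¬indep ∄g = ¬indep indep
  where
  indep : LinIndep (eraseAt l ∘ v)
  indep c erased≗0 with comb c v l ℚ.≟ 0ℚ
  ... | yes α≡0 = v-indep c λ j → helper j (l ≟ j)
    where
    helper : ∀ j → Dec (l ≡ j) → comb c v j ≡ 0ℚ
    helper j (yes refl) = α≡0
    helper j (no l≢j)   = trans (∙-congˡ c λ i → sym (eraseAt-off (v i) l≢j)) (erased≗0 j)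
  ... | no α≢0 = contradiction (scaled , λ j → unit j (l ≟ j)) ∄g
    where
    instance
      α-nonZero : NonZero (comb c v l)
      α-nonZero = ≢-nonZero α≢0
    β : ℚ
    β = 1/ comb c v l
    scaled : Fin _ → ℚ
    scaled i = β *ℚ c i
    comb-scaled : ∀ j → comb scaled v j ≡ β *ℚ comb c v j
    comb-scaled j = trans (sumℚ-cong λ i → ℚ.*-assoc β (c i) (v i j)) (sumℚ-*ˡ β λ i → c i *ℚ v i j)
    unit : ∀ j → Dec (l ≡ j) → comb scaled v j ≡ δ l j
    unit j (yes refl) = trans (comb-scaled j) (trans (ℚ.*-inverseˡ (comb c v l)) (sym (δ-diag {i = l} refl)))
    unit j (no l≢j)   = trans (comb-scaled j)
      (trans (cong (β *ℚ_) (trans (∙-congˡ c λ i → sym (eraseAt-off (v i) l≢j)) (erased≗0 j)))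
             (trans (ℚ.*-zeroʳ β) (sym (δ-off l≢j))))

-- This plays the role of the Laplace expansion of a nonzero minor along its first row: if erasing
-- column l makes the other rows dependent, then δ l is in their span, and this cannot happen for
-- every l in the support of the first row.
LinIndep⇒Transversal : {v : Fin d → Fin k → ℚ} → LinIndep v → ¬ ¬ Transversal v
LinIndep⇒Transversal {zero}  _       ∄ = ∄ ((λ ()) , (λ {}) , λ ())
LinIndep⇒Transversal {suc d} {k} {v} v-indep ∄ = ¬¬-∀-Fin unit (head∉span-tail {v = v} v-indep)
  where
  prepend : ∀ l → v fzero l ≢ 0ℚ → ¬ Transversal (eraseAt l ∘ v ∘ fsuc)
  prepend l v₀≢0 (f , f-inj , f≢0) = ∄ (l ∷ f , injective , λ { fzero → v₀≢0 ; (fsuc i) → entry≢0 i })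
    where
    l≢f : ∀ i → l ≢ f i
    l≢f i l≡f = f≢0 i (eraseAt-diag (v (fsuc i)) l≡f)
    entry≢0 : ∀ i → v (fsuc i) (f i) ≢ 0ℚ
    entry≢0 i = f≢0 i ∘ trans (eraseAt-off (v (fsuc i)) (l≢f i))
    injective : Injective _≡_ _≡_ (l ∷ f)
    injective {fzero}  {fzero}  _  = refl
    injective {fzero}  {fsuc j} eq = contradiction eq (l≢f j)
    injective {fsuc i} {fzero}  eq = contradiction (sym eq) (l≢f i)
    injective {fsuc i} {fsuc j} eq = cong fsuc (f-inj eq)
  unit : ∀ l → ¬ ¬ (∃ λ g → v fzero l ≢ 0ℚ → ∀ j → comb g (v ∘ fsuc) j ≡ δ l j)
  unit l ∄g with v fzero l ℚ.≟ 0ℚ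
  -- Any coefficients serve here: this column has weight 0 in the first row.
  ... | yes ≡0 = ∄g (const 0ℚ , λ ≢0 → contradiction ≡0 ≢0)
  ... | no  ≢0 = eraseAt-dependent {v = v ∘ fsuc} l (LinIndep-∘ {v = v} v-indep Fin.suc-injective)
    (λ indep → LinIndep⇒Transversal {v = eraseAt l ∘ v ∘ fsuc} indep (prepend l ≢0))
    λ (g , eq) → ∄g (g , λ _ → eq)

-- Splitting a finite set by colour.

-- Only an injection into the fibre is stored. That the two fibres exhaust `Fin d` is expressed by
-- `a + b ≡ d` in `fibres`.
record Fibre (p : Fin d → Bool) (b : Bool) (size : ℕ) : Set where
  field
    embed           : Fin size → Fin d
    embed-injective : Injective _≡_ _≡_ embed
    embed-∈         : ∀ i → p (embed i) ≡ b

module _ {p : Fin (suc d) → Bool} {b : Bool} (F : Fibre (p ∘ fsuc) b k) where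
  open Fibre F

  Fibre-skip : Fibre p b k
  Fibre-skip = record
    { embed = fsuc ∘ embed; embed-injective = embed-injective ∘ Fin.suc-injective; embed-∈ = embed-∈ }

  Fibre-cons : p fzero ≡ b → Fibre p b (suc k)
  Fibre-cons p₀≡b = record
    { embed           = fzero ∷ fsuc ∘ embed
    ; embed-injective = λ { {fzero} {fzero} _ → refl
                          ; {fsuc i} {fsuc j} eq → cong fsuc (embed-injective (Fin.suc-injective eq)) }
    ; embed-∈         = λ { fzero → p₀≡b ; (fsuc i) → embed-∈ i } }

fibres : (p : Fin d → Bool) → ∃₂ λ a b → a + b ≡ d × Fibre p true a × Fibre p false b
fibres {zero} p = 0 , 0 , refl , empty , empty
  where
  empty : ∀ {b} → Fibre p b 0
  empty = record { embed = λ (); embed-injective = λ {}; embed-∈ = λ () }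
fibres {suc d} p with p fzero in eq | fibres (p ∘ fsuc)
... | true  | a , b , a+b≡d , T , F = suc a , b , cong suc a+b≡d , Fibre-cons T eq , Fibre-skip F
... | false | a , b , a+b≡d , T , F = a , suc b , trans (ℕ.+-suc a b) (cong suc a+b≡d) , Fibre-skip T , Fibre-cons F eq

-- Signs in a vanishing sum, and the phase of period 4.

-- Serves as the sign of a nonzero rational; 0 would count as negative.
positive : ℚ → Bool
positive x = does (0ℚ ℚ.<? x)

sumℚ≥0 : (f : Fin k → ℚ) → (∀ i → 0ℚ ℚ.≤ f i) → 0ℚ ℚ.≤ sumℚ f
sumℚ≥0 {zero}  f f≥0 = ℚ.≤-refl
sumℚ≥0 {suc k} f f≥0 = ℚ.+-mono-≤ (f≥0 fzero) (sumℚ≥0 (f ∘ fsuc) (f≥0 ∘ fsuc))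

≤sumℚ : (f : Fin k → ℚ) → (∀ i → 0ℚ ℚ.≤ f i) → ∀ i → f i ℚ.≤ sumℚ f
≤sumℚ f f≥0 fzero    = subst (ℚ._≤ sumℚ f) (ℚ.+-identityʳ (f fzero))
  (ℚ.+-monoʳ-≤ (f fzero) (sumℚ≥0 (f ∘ fsuc) (f≥0 ∘ fsuc)))
≤sumℚ f f≥0 (fsuc i) = subst (ℚ._≤ sumℚ f) (ℚ.+-identityˡ (f (fsuc i)))
  (ℚ.+-mono-≤ (f≥0 fzero) (≤sumℚ (f ∘ fsuc) (f≥0 ∘ fsuc) i))

-- Without negative terms every term is at most the sum, which is 0.
negative-term : (f : Fin k → ℚ) → sumℚ f ≡ 0ℚ → ∀ i → 0ℚ ℚ.< f i → ∃ λ j → f j ℚ.< 0ℚ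
negative-term f sum≡0 i f>0 with Fin.any? (λ j → f j ℚ.<? 0ℚ)
... | yes found = found
... | no  none  = contradiction
  (ℚ.<-≤-trans f>0 (subst (f i ℚ.≤_) sum≡0 (≤sumℚ f (λ j → ℚ.≮⇒≥ (none ∘ (j ,_))) i)))
  (ℚ.<-irrefl refl)

opposite-term : (f : Fin k → ℚ) → sumℚ f ≡ 0ℚ → ∀ i → f i ≢ 0ℚ →
  ∃ λ j → f j ≢ 0ℚ × positive (f j) ≡ not (positive (f i))
opposite-term f sum≡0 i f≢0 with 0ℚ ℚ.<? f i
... | yes f>0 =
  let j , fj<0 = negative-term f sum≡0 i f>0
  in j , ℚ.<⇒≢ fj<0 ,
     trans (dec-false (0ℚ ℚ.<? f j) (ℚ.<-asym fj<0)) (cong not (sym (dec-true (0ℚ ℚ.<? f i) f>0)))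
... | no f≯0 =
  -- A negative term is handled by negating all terms; the factor `- 1ℚ` lets the sum be negated by
  -- distributivity.
  let j , -fj<0 = negative-term (λ i → - 1ℚ *ℚ f i) -sum≡0 i
        (subst (0ℚ ℚ.<_) (-1*x (f i)) (ℚ.neg-antimono-< f<0))
      fj>0 = subst (0ℚ ℚ.<_) (-[-1*x] (f j)) (ℚ.neg-antimono-< -fj<0)
  in j , ℚ.<⇒≢ fj>0 ∘ sym ,
     trans (dec-true (0ℚ ℚ.<? f j) fj>0) (cong not (sym (dec-false (0ℚ ℚ.<? f i) f≯0)))
  where
  open +-*-Solver
  -sum≡0 : sumℚ (λ i → - 1ℚ *ℚ f i) ≡ 0ℚ
  -sum≡0 = trans (sumℚ-*ˡ (- 1ℚ) f) (cong (- 1ℚ *ℚ_) sum≡0)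
  -1*x : ∀ x → - x ≡ - 1ℚ *ℚ x
  -1*x = solve 1 (λ x → :- x := con (- 1ℚ) :* x) refl
  -[-1*x] : ∀ x → - (- 1ℚ *ℚ x) ≡ x
  -[-1*x] = solve 1 (λ x → :- (con (- 1ℚ) :* x) := x) refl
  f<0 : f i ℚ.< 0ℚ
  f<0 = ℚ.≰⇒> λ f≥0 → f≢0 (ℚ.≤-antisym (ℚ.≮⇒≥ f≯0) f≥0)

-- The cyclic permutation of order 4 by which one step of the walk below moves (side, sign).
turn : Bool × Bool → Bool × Bool
turn (true  , σ) = false , σ
turn (false , σ) = true  , not σ

-- An odd number of turns changes the side, two turns negate the sign, and four are the identity.
turn-period : ∀ l φ → fold φ turn l ≡ φ → 4 ∣ l
turn-period 0 φ eq = 4 ∣0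
turn-period 1 (true  , _) ()
turn-period 1 (false , _) ()
turn-period 2 (true  , true)  ()
turn-period 2 (true  , false) ()
turn-period 2 (false , true)  ()
turn-period 2 (false , false) ()
turn-period 3 (true  , _) ()
turn-period 3 (false , _) ()
turn-period (suc (suc (suc (suc l)))) φ eq =
  ∣m∣n⇒∣m+n ∣-refl (turn-period l φ (trans (sym (turn⁴ (fold φ turn l))) eq))
  where
  turn⁴ : ∀ φ → turn (turn (turn (turn φ))) ≡ φ
  turn⁴ (true  , σ) = cong (true ,_) (not-involutive σ)
  turn⁴ (false , σ) = cong (false ,_) (not-involutive σ)

-- Graphs, and the bound n ≤ null + 2ν.

module _ (G : Graph) where

  private
    V : Set
    V = Fin (n G)
    A : V → V → ℚ
    A = adjMatrix G

  A≢0⇒Adj : ∀ i j → A i j ≢ 0ℚ → Adj G i j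
  A≢0⇒Adj i j A≢0 with adj G i j
  ... | true  = refl
  ... | false = contradiction refl A≢0

  Adj⇒A≡1 : ∀ {i j} → Adj G i j → A i j ≡ 1ℚ
  Adj⇒A≡1 i~j rewrite i~j = refl

  Matching-≤ : k ≤ d → Matching G d → Matching G k
  Matching-≤ k≤d M = record
    { left = left ∘ ι; right = right ∘ ι; edge = edge ∘ ι
    ; injL = Fin.inject≤-injective k≤d k≤d _ _ ∘ injL
    ; injR = Fin.inject≤-injective k≤d k≤d _ _ ∘ injR
    ; disj = λ i j → disj (ι i) (ι j) }
    where
    open Matching M
    ι = λ i → inject≤ i k≤d

  -- Rows of one colour have all their transversal columns in the other colour, so no left end is a
  -- right end.
  Fibre⇒Matching : ((c , _) : IsBipartite G) {pick f : Fin d → V} {b : Bool} →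
    Injective _≡_ _≡_ pick → Injective _≡_ _≡_ f → (∀ i → Adj G (pick i) (f i)) →
    Fibre (c ∘ pick) b k → Matching G k
  Fibre⇒Matching (c , proper) {pick} {f} pick-inj f-inj edges F = record
    { left = pick ∘ embed; right = f ∘ embed; edge = edges ∘ embed
    ; injL = embed-injective ∘ pick-inj; injR = embed-injective ∘ f-inj
    ; disj = λ i j eq → proper _ _ (edges (embed j))
        (trans (embed-∈ j) (trans (sym (embed-∈ i)) (cong c eq))) }
    where open Fibre F

  n≤nullity+2ν : IsBipartite G → ∀ {d m} → ¬ IndepNullFamily G (suc d) → ¬ Matching G (suc m) →
    n G ≤ d + 2 * m
  n≤nullity+2ν bip@(c , _) {d} {m} nullity≤d ν≤m =
    -- The inequality is decidable, so a transversal under double negation suffices.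
    decidable-stable (n G ℕ.≤? d + 2 * m) λ n≰ →
      LinIndep⇒Transversal {v = A ∘ pick} pick-independent λ (f , f-inj , Af≢0) →
        n≰ (subst (_≤ d + 2 * m) rank+nullity (subst (_≤ d + 2 * m) (ℕ.+-comm nullity rank)
          (ℕ.+-mono-≤ nullity≤ (rank≤ f-inj λ i → A≢0⇒Adj (pick i) (f i) (Af≢0 i)))))
    where
    open RankNullity (rankNullity A)
    nullity≤ : nullity ≤ d
    nullity≤ = ℕ.≮⇒≥ λ d<nullity → nullity≤d
      ( (λ i → ker (inject≤ i d<nullity))
      , LinIndep-∘ {v = ker} ker-independent (Fin.inject≤-injective d<nullity d<nullity _ _)
      , λ i j → ker-null j (inject≤ i d<nullity) )
    rank≤ : {f : Fin rank → V} → Injective _≡_ _≡_ f → (∀ i → Adj G (pick i) (f i)) → rank ≤ 2 * m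
    rank≤ f-inj edges with fibres (c ∘ pick)
    ... | a , b , a+b≡rank , T , F = subst (_≤ 2 * m) a+b≡rank
      (ℕ.+-mono-≤ (size≤ T) (subst (b ≤_) (sym (ℕ.+-identityʳ m)) (size≤ F)))
      where
      size≤ : ∀ {b k} → Fibre (c ∘ pick) b k → k ≤ m
      size≤ F = ℕ.≮⇒≥ λ m<k → ν≤m (Matching-≤ m<k (Fibre⇒Matching bip pick-injective f-inj edges F))

  -- Alternating walks and null vectors supported on a matching.

  -- A shortest closed segment of the walk is a cycle.
  walk⇒cycle : (u : ℕ → V) → (∀ t → Adj G (u t) (u (suc t))) →
    (∀ l t → u (l + t) ≡ u t → 4 ∣ l) → ∃ λ L → 4 ∣ L × Cycle G L
  walk⇒cycle u steps period =
    -- Among the first `n G + 1` positions two carry the same vertex.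
    let i , j , i<j , eq = Fin.pigeonhole (ℕ.n<1+n (n G)) (u ∘ toℕ)
    in shorten (<-wellFounded _) (toℕ i) (ℕ.m<n⇒0<n∸m i<j)
         (trans (cong u (ℕ.m∸n+n≡m (ℕ.<⇒≤ i<j))) (sym eq))
    where
    shorten : ∀ {l} → Acc _<_ l → ∀ t → 0 < l → u (l + t) ≡ u t → ∃ λ L → 4 ∣ L × Cycle G L
    shorten {l} (acc rec) t l>0 closed
      with Fin.any? {n = l} (λ i → Fin.any? {n = l} λ j → (i Fin.<? j) ×-dec (u (toℕ j + t) ≟ u (toℕ i + t)))
    -- A repetition within the segment is a closed segment of smaller length `toℕ j ∸ toℕ i`,
    -- starting at `toℕ i + t`.
    ... | yes (i , j , i<j , eq) = shorten
      (rec (ℕ.≤-<-trans (ℕ.m∸n≤m (toℕ j) (toℕ i)) (Fin.toℕ<n j))) (toℕ i + t) (ℕ.m<n⇒0<n∸m i<j)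
      (trans (cong u (trans (sym (ℕ.+-assoc (toℕ j ∸ toℕ i) (toℕ i) t))
                            (cong (_+ t) (ℕ.m∸n+n≡m (ℕ.<⇒≤ i<j))))) eq)
    ... | no simple = l , 4∣l , record
      -- A positive multiple of 4 is at least 4.
      { len≥3 = ℕ.≤-trans (ℕ.n≤1+n 3) (∣⇒≤ {{>-nonZero l>0}} 4∣l)
      ; vtx   = λ i → u (toℕ i + t)
      ; inj   = λ {i} {j} → injective i j
      ; step  = λ i j i+1≡j → subst (λ s → Adj G (u (toℕ i + t)) (u (s + t))) i+1≡j (steps (toℕ i + t))
      ; close = λ i j i+1≡l j≡0 → subst (Adj G (u (toℕ i + t)))
          (trans (trans (cong (λ s → u (s + t)) i+1≡l) closed) (cong (λ s → u (s + t)) (sym j≡0)))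
          (steps (toℕ i + t)) }
      where
      4∣l : 4 ∣ l
      4∣l = period l t closed
      injective : ∀ i j → u (toℕ i + t) ≡ u (toℕ j + t) → i ≡ j
      injective i j eq with Fin.<-cmp i j
      ... | tri< i<j _ _ = contradiction (i , j , i<j , sym eq) simple
      ... | tri≈ _ i≡j _ = i≡j
      ... | tri> _ _ j<i = contradiction (j , i , j<i , eq) simple

  Covered : Matching G k → V → Set
  Covered M v = ∃ λ i → left i ≡ v ⊎ right i ≡ v
    where open Matching M

  -- Each edge has exactly one end of colour `b`, which becomes its left end. This gives the walk a
  -- fixed direction on matching edges.
  orient : ((c , _) : IsBipartite G) (b : Bool) (M : Matching G k) →
    ∃ λ (M′ : Matching G k) → (∀ i → c (Matching.left M′ i) ≡ b) × (∀ v → Covered M v → Covered M′ v)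
  orient {k} (c , proper) b M = M′ , side , covered
    where
    open Matching M
    Oriented : Fin k → Set
    Oriented i = ∃₂ λ x y → Adj G x y × c x ≡ b ×
      ((x ≡ left i × y ≡ right i) ⊎ (x ≡ right i × y ≡ left i))
    oriented : ∀ i → Oriented i
    oriented i with c (left i) Bool.≟ b
    ... | yes ≡b = left i , right i , edge i , ≡b , inj₁ (refl , refl)
    ... | no  ≢b = right i , left i , trans (adj-sym G (right i) (left i)) (edge i)
      -- With two colours, `c (right i)` and `b` both differ from `c (left i)`, so they agree.
      , not-injective (trans (sym (¬-not (proper _ _ (edge i)))) (¬-not ≢b)) , inj₂ (refl , refl)
    x y : Fin k → V
    x i = proj₁ (oriented i)
    y i = proj₁ (proj₂ (oriented i))
    ends : ∀ i → (x i ≡ left i × y i ≡ right i) ⊎ (x i ≡ right i × y i ≡ left i)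
    ends i = proj₂ (proj₂ (proj₂ (proj₂ (oriented i))))
    side : ∀ i → c (x i) ≡ b
    side i = proj₁ (proj₂ (proj₂ (proj₂ (oriented i))))
    x~y : ∀ i → Adj G (x i) (y i)
    x~y i = proj₁ (proj₂ (proj₂ (oriented i)))
    -- The three injectivity and disjointness conditions in one form that is symmetric in the two
    -- ends, hence stable under swapping them.
    ends-injective : ∀ {i j v} → left i ≡ v ⊎ right i ≡ v → left j ≡ v ⊎ right j ≡ v → i ≡ j
    ends-injective (inj₁ p) (inj₁ q) = injL (trans p (sym q))
    ends-injective (inj₁ p) (inj₂ q) = contradiction (trans p (sym q)) (disj _ _)
    ends-injective (inj₂ p) (inj₁ q) = contradiction (trans q (sym p)) (disj _ _)
    ends-injective (inj₂ p) (inj₂ q) = injR (trans p (sym q))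
    x-end : ∀ i → left i ≡ x i ⊎ right i ≡ x i
    x-end i = Sum.map (sym ∘ proj₁) (sym ∘ proj₁) (ends i)
    y-end : ∀ i → left i ≡ y i ⊎ right i ≡ y i
    y-end i = Sum.swap (Sum.map (sym ∘ proj₂) (sym ∘ proj₂) (ends i))
    M′ : Matching G k
    M′ = record
      { left = x; right = y; edge = x~y
      ; injL = λ {i} {j} eq → ends-injective (x-end i) (subst (λ v → left j ≡ v ⊎ right j ≡ v) (sym eq) (x-end j))
      ; injR = λ {i} {j} eq → ends-injective (y-end i) (subst (λ v → left j ≡ v ⊎ right j ≡ v) (sym eq) (y-end j))
      ; disj = λ i j eq → proper _ _ (x~y j) (trans (side j) (trans (sym (side i)) (cong c eq))) }
    covered : ∀ v → Covered M v → Covered M′ v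
    covered v (i , e) with ends i | e
    ... | inj₁ (x≡l , y≡r) | inj₁ l≡v = i , inj₁ (trans x≡l l≡v)
    ... | inj₁ (x≡l , y≡r) | inj₂ r≡v = i , inj₂ (trans y≡r r≡v)
    ... | inj₂ (x≡r , y≡l) | inj₁ l≡v = i , inj₂ (trans y≡l l≡v)
    ... | inj₂ (x≡r , y≡l) | inj₂ r≡v = i , inj₁ (trans x≡r r≡v)

  module AlternatingWalk
    (c : V → Bool) (proper : ∀ i j → Adj G i j → c i ≢ c j)
    {b : Bool} (M : Matching G k) (side : ∀ i → c (Matching.left M i) ≡ b)
    (x : V → ℚ) (x-null : InNullSpace G x) (covered : ∀ v → x v ≢ 0ℚ → Covered M v) where
    open Matching M

    State : Set
    State = Bool × ∃ λ i → x (left i) ≢ 0ℚ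

    vertex : State → V
    vertex (true  , i , _) = left i
    vertex (false , i , _) = right i

    -- The sign at a right end is that of its partner, so crossing a matching edge keeps the sign
    -- and only the edge after it flips it, exactly as in `turn`.
    phase : State → Bool × Bool
    phase (β , i , _) = β , positive (x (left i))

    -- The row of `right i` in the null equation supplies a neighbour `v` of opposite sign. It is
    -- covered, and by its colour it can only be a left end.
    successor : ∀ i → x (left i) ≢ 0ℚ → ∃ λ j → x (left j) ≢ 0ℚ ×
      Adj G (right i) (left j) × positive (x (left j)) ≡ not (positive (x (left i)))
    successor i xi≢0
      with opposite-term (λ v → A (right i) v *ℚ x v) (x-null (right i)) (left i) (xi≢0 ∘ trans (sym Ax≡x))
      where
      Ax≡x : A (right i) (left i) *ℚ x (left i) ≡ x (left i)
      Ax≡x = trans (cong (_*ℚ x (left i)) (Adj⇒A≡1 (trans (adj-sym G (right i) (left i)) (edge i))))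
                   (ℚ.*-identityˡ _)
    ... | v , Ax≢0 , opposite = found (covered v xv≢0)
      where
      i~v : Adj G (right i) v
      i~v = A≢0⇒Adj (right i) v λ A≡0 → Ax≢0 (trans (cong (_*ℚ x v) A≡0) (ℚ.*-zeroˡ (x v)))
      Ax≡x : ∀ {v} → Adj G (right i) v → A (right i) v *ℚ x v ≡ x v
      Ax≡x {v} i~v = trans (cong (_*ℚ x v) (Adj⇒A≡1 i~v)) (ℚ.*-identityˡ (x v))
      xv≢0 : x v ≢ 0ℚ
      xv≢0 = Ax≢0 ∘ trans (Ax≡x i~v)
      sign : positive (x v) ≡ not (positive (x (left i)))
      sign = trans (cong positive (sym (Ax≡x i~v)))
        (trans opposite (cong (not ∘ positive) (Ax≡x (trans (adj-sym G (right i) (left i)) (edge i)))))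
      found : Covered M v → _
      found (j , inj₁ refl) = j , xv≢0 , i~v , sign
      found (j , inj₂ refl) = contradiction same-side (proper _ _ i~v)
        where
        right-side : ∀ i → c (right i) ≡ not b
        right-side i = trans (¬-not (proper _ _ (edge i) ∘ sym)) (cong not (side i))
        same-side : c (right i) ≡ c (right j)
        same-side = trans (right-side i) (sym (right-side j))

    next : State → State
    next (true  , i , xi≢0) = false , i , xi≢0
    next (false , i , xi≢0) = let j , xj≢0 , _ = successor i xi≢0 in true , j , xj≢0

    vertex-next : ∀ s → Adj G (vertex s) (vertex (next s))
    vertex-next (true  , i , xi≢0) = edge i
    vertex-next (false , i , xi≢0) = let _ , _ , i~j , _ = successor i xi≢0 in i~j

    phase-next : ∀ s → phase (next s) ≡ turn (phase s)
    phase-next (true  , i , xi≢0) = refl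
    phase-next (false , i , xi≢0) = let _ , _ , _ , sign = successor i xi≢0 in cong (true ,_) sign

    phase-walk : ∀ s l → phase (fold s next l) ≡ fold (phase s) turn l
    phase-walk s zero    = refl
    phase-walk s (suc l) = trans (phase-next (fold s next l)) (cong turn (phase-walk s l))

    -- States carry proofs, so a repeated vertex need not repeat the state. It does fix the matching
    -- edge and the side, hence the phase.
    vertex≡⇒phase≡ : ∀ s t → vertex s ≡ vertex t → phase s ≡ phase t
    vertex≡⇒phase≡ (true  , i , _) (true  , j , _) eq = cong (λ i → true , positive (x (left i))) (injL eq)
    vertex≡⇒phase≡ (true  , i , _) (false , j , _) eq = contradiction eq (disj i j)
    vertex≡⇒phase≡ (false , i , _) (true  , j , _) eq = contradiction (sym eq) (disj j i)
    vertex≡⇒phase≡ (false , i , _) (false , j , _) eq = cong (λ i → false , positive (x (left i))) (injR eq)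

    cycle : ∀ i → x (left i) ≢ 0ℚ → ∃ λ L → 4 ∣ L × Cycle G L
    cycle i xi≢0 = walk⇒cycle (vertex ∘ walk) (λ t → vertex-next (walk t)) λ l t eq →
      turn-period l (phase (walk t)) (trans (sym (phase-walk (walk t) l))
        (trans (cong phase (sym (fold-+ start next l))) (vertex≡⇒phase≡ (walk (l + t)) (walk t) eq)))
      where
      start : State
      start = true , i , xi≢0
      walk : ℕ → State
      walk = fold start next

  null-supported-on-matching : IsBipartite G → IsC4kFree G → (M : Matching G k) (x : V → ℚ) →
    InNullSpace G x → (∀ v → x v ≢ 0ℚ → Covered M v) → ∀ v → x v ≡ 0ℚ
  null-supported-on-matching bip@(c , proper) C4k-free M x x-null covered v =
    decidable-stable (x v ℚ.≟ 0ℚ) λ xv≢0 →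
      -- Orienting by the colour of `v` itself makes `v` a left end, where the walk can start.
      let M′ , side , covered′ = orient bip (c v) M
      in absurd M′ side (λ w → covered′ w ∘ covered w) xv≢0 (covered′ v (covered v xv≢0))
    where
    absurd : (M : Matching G _) → (∀ i → c (Matching.left M i) ≡ c v) → (∀ v → x v ≢ 0ℚ → Covered M v) →
      x v ≢ 0ℚ → ¬ Covered M v
    absurd M side covered xv≢0 (i , inj₁ l≡v) =
      let L , 4∣L , C = AlternatingWalk.cycle c proper M side x x-null covered i (xv≢0 ∘ trans (cong x (sym l≡v)))
      in C4k-free L 4∣L C
    absurd M side covered xv≢0 (i , inj₂ r≡v) =
      proper _ _ (Matching.edge M i) (trans (side i) (cong c (sym r≡v)))

  -- The bound null + 2ν ≤ n and the conclusion.

  nullity+2ν≤n : IsBipartite G → IsC4kFree G → IndepNullFamily G d → Matching G k → d + 2 * k ≤ n G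
  nullity+2ν≤n {d} {k} bip C4k-free (v , v-indep , v-null) M =
    subst (λ m → d + (k + m) ≤ n G) (sym (ℕ.+-identityʳ k))
      (LinIndep⇒≤ {v = v ++ (δ ∘ ends)} (LinIndep-++ v-indep (LinIndep-δ ends-injective) disjoint))
    where
    open Matching M
    end : Fin k ⊎ Fin k → V
    end = [ left , right ]
    end-injective : Injective _≡_ _≡_ end
    end-injective {inj₁ i} {inj₁ j} eq = cong inj₁ (injL eq)
    end-injective {inj₁ i} {inj₂ j} eq = contradiction eq (disj i j)
    end-injective {inj₂ i} {inj₁ j} eq = contradiction (sym eq) (disj j i)
    end-injective {inj₂ i} {inj₂ j} eq = cong inj₂ (injR eq)
    ends : Fin (k + k) → V
    ends = end ∘ splitAt k
    ends-injective : Injective _≡_ _≡_ ends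
    ends-injective {i} {j} eq = trans (sym (Fin.join-splitAt k k i))
      (trans (cong (join k k) (end-injective {splitAt k i} {splitAt k j} eq)) (Fin.join-splitAt k k j))
    ends-covered : ∀ i → Covered M (ends i)
    ends-covered i with splitAt k i
    ... | inj₁ j = j , inj₁ refl
    ... | inj₂ j = j , inj₂ refl
    disjoint : ∀ a b → (∀ j → comb a v j +ℚ comb b (δ ∘ ends) j ≡ 0ℚ) → ∀ j → comb a v j ≡ 0ℚ
    disjoint a b sum≗0 = null-supported-on-matching bip C4k-free M (comb a v) null covered
      where
      null : InNullSpace G (comb a v)
      null i = trans (∙-comm (A i) (comb a v)) (trans (comb-∙ a v (A i))
        (∙-zeroʳ a λ l → trans (∙-comm (v l) (A i)) (v-null l i)))
      covered : ∀ j → comb a v j ≢ 0ℚ → Covered M j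
      covered j x≢0 with Fin.any? (λ i → ends i ≟ j)
      ... | yes (i , refl) = ends-covered i
      -- Off the matched vertices the unit vectors contribute nothing, so the null vector must
      -- vanish there.
      ... | no  ∉ends      = contradiction
        (trans (sym (ℚ.+-identityʳ _)) (trans (cong (comb a v j +ℚ_)
          (sym (comb-δ-outside b {ι = ends} λ i → ∉ends ∘ (i ,_)))) (sum≗0 j))) x≢0

theorem4p2 : (G : Graph) → IsBipartite G → IsC4kFree G →
    ∀ (d m : ℕ) → IsNullity G d → IsMatchingNumber G m →
    d + 2 * m ≡ n G
theorem4p2 G bip C4k-free d m (null-family , nullity≤d) (M , ν≤m) = ℕ.≤-antisym
  (nullity+2ν≤n G bip C4k-free null-family M) (n≤nullity+2ν G bip nullity≤d ν≤m)
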